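{- Let $\mathbf{X}$ be an $\mathcal{M},\mathcal{N}$-adhesive category with pullbacks. If $\mathcal{M}\cap\mathcal{N}$ contains all split monomorphisms and $\mathcal{N}$ contains all $\mathcal{M},\mathcal{N}$-codiagonals, then $\mathcal{M}$ is closed under $\mathcal{M},\mathcal{N}$-unions.
   Context: Classes of arrows. A class $\mathcal{A}$ of arrows is stable under pullbacks (resp. pushouts) if for every pullback (resp. pushout) square with $f:A\to B$, $m:A\to C$, $n:B\to D$, $g:C\to D$, $n\circ f=g\circ m$, $n\in\mathcal{A}$ implies $m\in\mathcal{A}$ (resp. $m\in\mathcal{A}$ implies $n\in\mathcal{A}$); existence of the (co)limits is not assumed. $\mathcal{A}$ is closed under $\mathcal{B}$-decomposition if $g\circ f\in\mathcal{A}$ and $g\in\mathcal{B}$ imply $f\in\mathcal{A}$; closed under decomposition means closed under $\mathcal{A}$-decomposition. Preadhesive structure. A pair $(\mathcal{M},\mathcal{N})$ with $\mathcal{M}$ a class of monomorphisms and $\mathcal{N}$ a class of arrows of $\mathbf{X}$ such that: (1) $\mathcal{M}$ and $\mathcal{N}$ contain all isomorphisms and are closed under composition and decomposition; (2) $\mathcal{N}$ is closed under $\mathcal{M}$-decomposition; (3) $\mathcal{M}$ and $\mathcal{N}$ are stable under pullbacks and pushouts. Van Kampen squares. A pushout square $g:A\to B$, $m:A\to C$, $n:B\to D$, $f:C\to D$ is Van Kampen if for every commutative cube having it as bottom face, with top face $g':A'\to B'$, $m':A'\to C'$, $n':B'\to D'$, $f':C'\to D'$ and vertical arrows $a:A'\to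 A$, $b:B'\to B$, $c:C'\to C$, $d:D'\to D$, such that the two vertical faces containing $a$ are pullbacks, the top face is a pushout if and only if the two vertical faces containing $d$ are pullbacks. $\mathcal{M},\mathcal{N}$-adhesivity. $\mathbf{X}$ is $\mathcal{M},\mathcal{N}$-adhesive if $(\mathcal{M},\mathcal{N})$ is a preadhesive structure on $\mathbf{X}$ and: (1) pullbacks of arrows in $\mathcal{M}$ along arbitrary arrows exist; (2) for $m:X\to Y$ in $\mathcal{M}$ and $n:X\to Z$ in $\mathcal{N}$ a pushout of $m$ and $n$ exists (an $\mathcal{M},\mathcal{N}$-pushout); (3) $\mathcal{M},\mathcal{N}$-pushouts are Van Kampen squares. Codiagonals. If $f:X\to Y$ admits a pushout along itself, with coprojections $y_1,y_2:Y\rightrightarrows Q_f$, its codiagonal $\upsilon_f:Q_f\to Y$ is the unique arrow with $\upsilon_f\circ y_1=\mathrm{id}_Y=\upsilon_f\circ y_2$. An $\mathcal{M},\mathcal{N}$-codiagonal is the codiagonal of an arrow $n\in\mathcal{M}\cap\mathcal{N}$. Unions. $(\mathsf{Sub}(X),\le)$ is the poset of subobjects of $X$ (isomorphism classes $[m]$ of monos into $X$, ordered by factorization). A mono $u:U\to X$ is an $\mathcal{M},\mathcal{N}$-union if there are $m\in\mathcal{M}$ and $n\in\mathcal{M}\cap\mathcal{N}$ with codomain $X$ such that $[u]=[m]\vee[n]$ in $(\mathsf{Sub}(X),\le)$. $\mathcal{M}$ is closed under $\mathcal{M},\mathcal{N}$-unions if it contains all such monos. A split monomorphism is an arrow having a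 left inverse. -}

module Defs where

open import Level using (Level; suc; _⊔_)
open import Data.Product.Base using (Σ-syntax; ∃-syntax; _×_; _,_; proj₁)
open import Function.Bundles using (_⇔_)
open import Relation.Binary.Core using (Rel)
open import Relation.Binary.Structures using (IsEquivalence)
open import Relation.Binary.Bundles using (Setoid; Poset)
import Relation.Binary.Reasoning.Setoid as SetoidReasoning

-- Categories with a setoid of arrows between any two objects; equality of
-- arrows is always _≈_, and objects are never compared.

record Category (o ℓ e : Level) : Set (suc (o ⊔ ℓ ⊔ e)) where
  infix  4 _≈_ _⇒_
  infixr 9 _∘_
  field
    Obj : Set o
    _⇒_ : Rel Obj ℓ
    _≈_ : ∀ {A B} → Rel (A ⇒ B) e
    id  : ∀ {A} → A ⇒ A
    _∘_ : ∀ {A B C} → B ⇒ C → A ⇒ B → A ⇒ C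

    assoc     : ∀ {A B C D} {f : A ⇒ B} {g : B ⇒ C} {h : C ⇒ D} →
                (h ∘ g) ∘ f ≈ h ∘ (g ∘ f)
    identityˡ : ∀ {A B} {f : A ⇒ B} → id ∘ f ≈ f
    identityʳ : ∀ {A B} {f : A ⇒ B} → f ∘ id ≈ f
    equiv     : ∀ {A B} → IsEquivalence (_≈_ {A} {B})
    ∘-resp-≈  : ∀ {A B C} {f f′ : B ⇒ C} {g g′ : A ⇒ B} →
                f ≈ f′ → g ≈ g′ → f ∘ g ≈ f′ ∘ g′

  module Equiv {A B : Obj} = IsEquivalence (equiv {A} {B})

  homSetoid : Obj → Obj → Setoid ℓ e
  homSetoid A B = record { isEquivalence = equiv {A} {B} }

  ∘-resp-≈ˡ : ∀ {A B C} {f f′ : B ⇒ C} {g : A ⇒ B} → f ≈ f′ → f ∘ g ≈ f′ ∘ g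
  ∘-resp-≈ˡ p = ∘-resp-≈ p Equiv.refl

  ∘-resp-≈ʳ : ∀ {A B C} {f : B ⇒ C} {g g′ : A ⇒ B} → g ≈ g′ → f ∘ g ≈ f ∘ g′
  ∘-resp-≈ʳ p = ∘-resp-≈ Equiv.refl p

record ArrowClass {o ℓ e} (X : Category o ℓ e) (p : Level) :
                  Set (o ⊔ ℓ ⊔ e ⊔ suc p) where
  open Category X
  field
    Contains : ∀ {A B} → A ⇒ B → Set p
    resp-≈   : ∀ {A B} {f g : A ⇒ B} → f ≈ g → Contains f → Contains g

module _ {o ℓ e} {X : Category o ℓ e} where
  open Category X

  infix  4 _∈_ _⊆_
  infixr 7 _∩_

  _∈_ : ∀ {p A B} → A ⇒ B → ArrowClass X p → Set p
  f ∈ 𝒜 = ArrowClass.Contains 𝒜 f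

  _⊆_ : ∀ {p q} → ArrowClass X p → ArrowClass X q → Set (o ⊔ ℓ ⊔ p ⊔ q)
  𝒜 ⊆ ℬ = ∀ {A B} {f : A ⇒ B} → f ∈ 𝒜 → f ∈ ℬ

  _∩_ : ∀ {p q} → ArrowClass X p → ArrowClass X q → ArrowClass X (p ⊔ q)
  𝒜 ∩ ℬ = record
    { Contains = λ f → f ∈ 𝒜 × f ∈ ℬ
    ; resp-≈   = λ f≈g (a , b) →
        ArrowClass.resp-≈ 𝒜 f≈g a , ArrowClass.resp-≈ ℬ f≈g b
    }

module _ {o ℓ e} (X : Category o ℓ e) where
  open Category X

  IsIso : ∀ {A B} → A ⇒ B → Set (ℓ ⊔ e)
  IsIso {A} {B} f = Σ[ g ∈ B ⇒ A ] g ∘ f ≈ id × f ∘ g ≈ id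

  IsMono : ∀ {A B} → A ⇒ B → Set (o ⊔ ℓ ⊔ e)
  IsMono {A} f = ∀ {Z} (g h : Z ⇒ A) → f ∘ g ≈ f ∘ h → g ≈ h

  IsSplitMono : ∀ {A B} → A ⇒ B → Set (ℓ ⊔ e)
  IsSplitMono {A} {B} f = Σ[ r ∈ B ⇒ A ] r ∘ f ≈ id

  Isos : ArrowClass X (ℓ ⊔ e)
  Isos = record
    { Contains = IsIso
    ; resp-≈   = λ f≈f′ (g , gf , fg) →
        g , Equiv.trans (∘-resp-≈ʳ (Equiv.sym f≈f′)) gf
          , Equiv.trans (∘-resp-≈ˡ (Equiv.sym f≈f′)) fg
    }

  Monos : ArrowClass X (o ⊔ ℓ ⊔ e)
  Monos = record
    { Contains = IsMono
    ; resp-≈   = λ f≈f′ mono g h f′g≈f′h →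
        mono g h (Equiv.trans (∘-resp-≈ˡ f≈f′)
                 (Equiv.trans f′g≈f′h (∘-resp-≈ˡ (Equiv.sym f≈f′))))
    }

  SplitMonos : ArrowClass X (ℓ ⊔ e)
  SplitMonos = record
    { Contains = IsSplitMono
    ; resp-≈   = λ f≈f′ (r , rf) →
        r , Equiv.trans (∘-resp-≈ʳ (Equiv.sym f≈f′)) rf
    }

  -- In both records below the arguments are the sides of the square
  --
  --        f
  --     A ───→ B
  --   m │      │ n
  --     ↓      ↓
  --     C ───→ D
  --        g

  record IsPullback {A B C D} (f : A ⇒ B) (m : A ⇒ C) (n : B ⇒ D) (g : C ⇒ D) :
                    Set (o ⊔ ℓ ⊔ e) where
    field
      commute   : n ∘ f ≈ g ∘ m
      universal : ∀ {Z} {h : Z ⇒ B} {k : Z ⇒ C} → n ∘ h ≈ g ∘ k → Z ⇒ A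
      f∘universal : ∀ {Z} {h : Z ⇒ B} {k : Z ⇒ C} (eq : n ∘ h ≈ g ∘ k) →
                    f ∘ universal eq ≈ h
      m∘universal : ∀ {Z} {h : Z ⇒ B} {k : Z ⇒ C} (eq : n ∘ h ≈ g ∘ k) →
                    m ∘ universal eq ≈ k
      unique    : ∀ {Z} {h : Z ⇒ B} {k : Z ⇒ C} (eq : n ∘ h ≈ g ∘ k) {u : Z ⇒ A} →
                  f ∘ u ≈ h → m ∘ u ≈ k → u ≈ universal eq

  record IsPushout {A B C D} (f : A ⇒ B) (m : A ⇒ C) (n : B ⇒ D) (g : C ⇒ D) :
                   Set (o ⊔ ℓ ⊔ e) where
    field
      commute   : n ∘ f ≈ g ∘ m
      universal : ∀ {Z} {h : B ⇒ Z} {k : C ⇒ Z} → h ∘ f ≈ k ∘ m → D ⇒ Z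
      universal∘n : ∀ {Z} {h : B ⇒ Z} {k : C ⇒ Z} (eq : h ∘ f ≈ k ∘ m) →
                    universal eq ∘ n ≈ h
      universal∘g : ∀ {Z} {h : B ⇒ Z} {k : C ⇒ Z} (eq : h ∘ f ≈ k ∘ m) →
                    universal eq ∘ g ≈ k
      unique    : ∀ {Z} {h : B ⇒ Z} {k : C ⇒ Z} (eq : h ∘ f ≈ k ∘ m) {u : D ⇒ Z} →
                  u ∘ n ≈ h → u ∘ g ≈ k → u ≈ universal eq

  record Pullback {B C D} (n : B ⇒ D) (g : C ⇒ D) : Set (o ⊔ ℓ ⊔ e) where
    field
      {P}        : Obj
      p₁         : P ⇒ B
      p₂         : P ⇒ C
      isPullback : IsPullback p₁ p₂ n g

  record Pushout {A B C} (f : A ⇒ B) (m : A ⇒ C) : Set (o ⊔ ℓ ⊔ e) where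
    field
      {Q}       : Obj
      i₁        : B ⇒ Q
      i₂        : C ⇒ Q
      isPushout : IsPushout f m i₁ i₂

  HasPullbacks : Set (o ⊔ ℓ ⊔ e)
  HasPullbacks = ∀ {B C D} (n : B ⇒ D) (g : C ⇒ D) → Pullback n g

  StableUnderPullbacks : ∀ {p} → ArrowClass X p → Set (o ⊔ ℓ ⊔ e ⊔ p)
  StableUnderPullbacks 𝒜 =
    ∀ {A B C D} {f : A ⇒ B} {m : A ⇒ C} {n : B ⇒ D} {g : C ⇒ D} →
    IsPullback f m n g → n ∈ 𝒜 → m ∈ 𝒜

  StableUnderPushouts : ∀ {p} → ArrowClass X p → Set (o ⊔ ℓ ⊔ e ⊔ p)
  StableUnderPushouts 𝒜 =
    ∀ {A B C D} {f : A ⇒ B} {m : A ⇒ C} {n : B ⇒ D} {g : C ⇒ D} →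
    IsPushout f m n g → m ∈ 𝒜 → n ∈ 𝒜

  ClosedUnderComposition : ∀ {p} → ArrowClass X p → Set (o ⊔ ℓ ⊔ p)
  ClosedUnderComposition 𝒜 =
    ∀ {A B C} {f : A ⇒ B} {g : B ⇒ C} → g ∈ 𝒜 → f ∈ 𝒜 → g ∘ f ∈ 𝒜

  ClosedUnderDecompositionBy : ∀ {p q} → ArrowClass X p → ArrowClass X q →
                               Set (o ⊔ ℓ ⊔ p ⊔ q)
  ClosedUnderDecompositionBy ℬ 𝒜 =
    ∀ {A B C} {f : A ⇒ B} {g : B ⇒ C} → g ∘ f ∈ 𝒜 → g ∈ ℬ → f ∈ 𝒜

  ClosedUnderDecomposition : ∀ {p} → ArrowClass X p → Set (o ⊔ ℓ ⊔ p)
  ClosedUnderDecomposition 𝒜 = ClosedUnderDecompositionBy 𝒜 𝒜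

  record IsPreadhesive {p q} (ℳ : ArrowClass X p) (𝒩 : ArrowClass X q) :
                       Set (o ⊔ ℓ ⊔ e ⊔ p ⊔ q) where
    field
      ℳ⊆Monos          : ℳ ⊆ Monos
      Isos⊆ℳ           : Isos ⊆ ℳ
      Isos⊆𝒩           : Isos ⊆ 𝒩
      ℳ-composition    : ClosedUnderComposition ℳ
      𝒩-composition    : ClosedUnderComposition 𝒩
      ℳ-decomposition  : ClosedUnderDecomposition ℳ
      𝒩-decomposition  : ClosedUnderDecomposition 𝒩
      𝒩-ℳ-decomposition : ClosedUnderDecompositionBy ℳ 𝒩
      ℳ-pullback       : StableUnderPullbacks ℳ
      𝒩-pullback       : StableUnderPullbacks 𝒩
      ℳ-pushout        : StableUnderPushouts ℳ
      𝒩-pushout        : StableUnderPushouts 𝒩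

  record IsVanKampen {A B C D} (g : A ⇒ B) (m : A ⇒ C) (n : B ⇒ D) (f : C ⇒ D) :
                     Set (o ⊔ ℓ ⊔ e) where
    field
      isPushout : IsPushout g m n f
      -- The cube over the square; the two faces containing a commute because
      -- they are pullbacks, the other three vertical and top faces by the
      -- explicit equations.
      cube : ∀ {A′ B′ C′ D′}
             {g′ : A′ ⇒ B′} {m′ : A′ ⇒ C′} {n′ : B′ ⇒ D′} {f′ : C′ ⇒ D′}
             {a : A′ ⇒ A} {b : B′ ⇒ B} {c : C′ ⇒ C} {d : D′ ⇒ D} →
             n′ ∘ g′ ≈ f′ ∘ m′ →
             d ∘ n′ ≈ n ∘ b →
             d ∘ f′ ≈ f ∘ c →
             IsPullback g′ a b g →
             IsPullback m′ a c m →
             IsPushout g′ m′ n′ f′ ⇔ (IsPullback n′ b d n × IsPullback f′ c d f)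

  record IsAdhesive {p q} (ℳ : ArrowClass X p) (𝒩 : ArrowClass X q) :
                    Set (o ⊔ ℓ ⊔ e ⊔ p ⊔ q) where
    field
      isPreadhesive : IsPreadhesive ℳ 𝒩
      ℳ-pullbacks   : ∀ {B C D} (m : B ⇒ D) (g : C ⇒ D) → m ∈ ℳ → Pullback m g
      ℳ𝒩-pushouts   : ∀ {A B C} (m : A ⇒ B) (n : A ⇒ C) → m ∈ ℳ → n ∈ 𝒩 →
                      Pushout m n
      ℳ𝒩-vanKampen  : ∀ {A B C D} {m : A ⇒ B} {n : A ⇒ C} {i : B ⇒ D} {j : C ⇒ D} →
                      m ∈ ℳ → n ∈ 𝒩 → IsPushout m n i j → IsVanKampen m n i j

  -- Any pushout of f along itself may be used: pushouts are not chosen.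
  record IsCodiagonalOf {A B Q} (f : A ⇒ B) (υ : Q ⇒ B) : Set (o ⊔ ℓ ⊔ e) where
    field
      y₁ y₂     : B ⇒ Q
      isPushout : IsPushout f f y₁ y₂
      υ∘y₁      : υ ∘ y₁ ≈ id
      υ∘y₂      : υ ∘ y₂ ≈ id

  Codiagonals : ∀ {p q} → ArrowClass X p → ArrowClass X q →
                ArrowClass X (o ⊔ ℓ ⊔ e ⊔ p ⊔ q)
  Codiagonals ℳ 𝒩 = record
    { Contains = λ {_} {B} υ →
        ∃[ A ] Σ[ n ∈ A ⇒ B ] n ∈ ℳ ∩ 𝒩 × IsCodiagonalOf n υ
    ; resp-≈   = λ υ≈υ′ (A , n , n∈ , c) → let module c = IsCodiagonalOf c in
        A , n , n∈ , record
          { y₁        = c.y₁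
          ; y₂        = c.y₂
          ; isPushout = c.isPushout
          ; υ∘y₁      = Equiv.trans (∘-resp-≈ˡ (Equiv.sym υ≈υ′)) c.υ∘y₁
          ; υ∘y₂      = Equiv.trans (∘-resp-≈ˡ (Equiv.sym υ≈υ′)) c.υ∘y₂
          }
    }

  record Subobject (B : Obj) : Set (o ⊔ ℓ ⊔ e) where
    field
      {dom} : Obj
      arrow : dom ⇒ B
      mono  : IsMono arrow

  open Subobject

  Factors : ∀ {A B C} → A ⇒ C → B ⇒ C → Set (ℓ ⊔ e)
  Factors {A} {B} m n = Σ[ h ∈ A ⇒ B ] n ∘ h ≈ m

  -- Isomorphism classes are represented by the equality of the poset: two
  -- monos are equal when an isomorphism between their domains relates them.
  Sub : Obj → Poset (o ⊔ ℓ ⊔ e) (ℓ ⊔ e) (ℓ ⊔ e)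
  Sub B = record
    { Carrier        = Subobject B
    ; _≈_            = _≅_
    ; _≤_            = λ m n → Factors (arrow m) (arrow n)
    ; isPartialOrder = record
      { isPreorder = record
        { isEquivalence = record
          { refl  = (id , identityʳ) , id , identityˡ , identityˡ
          ; sym   = λ ((h , nh≈m) , k , kh , hk) →
              (k , Equiv.trans (∘-resp-≈ˡ (Equiv.sym nh≈m))
                  (Equiv.trans assoc (Equiv.trans (∘-resp-≈ʳ hk) identityʳ)))
              , h , hk , kh
          ; trans = λ ((h , p) , h⁻¹ , l , r) ((k , q) , k⁻¹ , l′ , r′) →
              ≤-trans (h , p) (k , q) , h⁻¹ ∘ k⁻¹ , cancel l′ l , cancel r r′
          }
        ; reflexive = proj₁
        ; trans     = ≤-trans
        }
      ; antisym = λ {m} {n} (h , p) (k , q) →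
          (h , p) , k , inverse m p q , inverse n q p
      }
    }
    where
    _≅_ : Rel (Subobject B) (ℓ ⊔ e)
    m ≅ n = Σ[ (h , _) ∈ Factors (arrow m) (arrow n) ] IsIso h

    ≤-trans : ∀ {A C D} {m : A ⇒ B} {n : C ⇒ B} {l : D ⇒ B} →
              Factors m n → Factors n l → Factors m l
    ≤-trans (h , p) (k , q) =
      k ∘ h , Equiv.trans (Equiv.sym assoc) (Equiv.trans (∘-resp-≈ˡ q) p)

    cancel : ∀ {A C D} {h : A ⇒ C} {h′ : C ⇒ A} {k : C ⇒ D} {k′ : D ⇒ C} →
             k′ ∘ k ≈ id → h′ ∘ h ≈ id → (h′ ∘ k′) ∘ (k ∘ h) ≈ id
    cancel {A} {h = h} {h′} {k} {k′} l r = begin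
      (h′ ∘ k′) ∘ (k ∘ h) ≈⟨ assoc ⟩
      h′ ∘ (k′ ∘ (k ∘ h)) ≈⟨ ∘-resp-≈ʳ (Equiv.sym assoc) ⟩
      h′ ∘ ((k′ ∘ k) ∘ h) ≈⟨ ∘-resp-≈ʳ (∘-resp-≈ˡ l) ⟩
      h′ ∘ (id ∘ h)       ≈⟨ ∘-resp-≈ʳ identityˡ ⟩
      h′ ∘ h              ≈⟨ r ⟩
      id                  ∎
      where open SetoidReasoning (homSetoid A A)

    inverse : ∀ (m : Subobject B) {C} {n : C ⇒ B} {h : dom m ⇒ C} {k : C ⇒ dom m} →
              n ∘ h ≈ arrow m → arrow m ∘ k ≈ n → k ∘ h ≈ id
    inverse m {n = n} {h} {k} p q = mono m _ _ (begin
      arrow m ∘ (k ∘ h) ≈⟨ Equiv.sym assoc ⟩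
      (arrow m ∘ k) ∘ h ≈⟨ ∘-resp-≈ˡ q ⟩
      n ∘ h             ≈⟨ p ⟩
      arrow m           ≈⟨ Equiv.sym identityʳ ⟩
      arrow m ∘ id      ∎)
      where open SetoidReasoning (homSetoid _ _)

  IsJoin : ∀ {c ℓ₁ ℓ₂} (P : Poset c ℓ₁ ℓ₂) → let open Poset P in
           Carrier → Carrier → Carrier → Set (c ⊔ ℓ₂)
  IsJoin P x y j = x ≤ j × y ≤ j × (∀ z → x ≤ z → y ≤ z → j ≤ z)
    where open Poset P

  Unions : ∀ {p q} → ArrowClass X p → ArrowClass X q →
           ArrowClass X (o ⊔ ℓ ⊔ e ⊔ p ⊔ q)
  Unions ℳ 𝒩 = record
    { Contains = λ {_} {B} u →
        Σ[ u-mono ∈ IsMono u ] Σ[ m ∈ Subobject B ] Σ[ n ∈ Subobject B ]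
        arrow m ∈ ℳ × arrow n ∈ ℳ ∩ 𝒩 ×
        IsJoin (Sub B) m n (record { arrow = u ; mono = u-mono })
    ; resp-≈   = λ u≈u′ (u-mono , m , n , m∈ , n∈ , (h , p) , (k , q) , least) →
        ArrowClass.resp-≈ Monos u≈u′ u-mono , m , n , m∈ , n∈ ,
        (h , Equiv.trans (∘-resp-≈ˡ (Equiv.sym u≈u′)) p) ,
        (k , Equiv.trans (∘-resp-≈ˡ (Equiv.sym u≈u′)) q) ,
        λ z m≤z n≤z → let (l , r) = least z m≤z n≤z in l , Equiv.trans r u≈u′
    }

  ClosedUnderUnions : ∀ {p q} → ArrowClass X p → ArrowClass X q →
                      Set (o ⊔ ℓ ⊔ e ⊔ p ⊔ q)
  ClosedUnderUnions ℳ 𝒩 = Unions ℳ 𝒩 ⊆ ℳ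

{-# OPTIONS --safe #-}
-- Let n : N → B be in ℳ ∩ 𝒩 and m : M → B in ℳ.  Glue two copies of B along N
-- to get Q with coprojections y₁, y₂ and codiagonal υ ∈ 𝒩, and pull m back
-- along υ to K, which sits in Q by k ∈ ℳ and maps to M by ∇ ∈ 𝒩.  Pushing k out
-- along ∇ gives q : Q → W, which identifies the two copies of M in Q, so that W
-- is two copies of B glued along the union.  The composites w₁ = q ∘ y₁ and
-- w₂ = q ∘ y₂ are split monos, hence the pullback r of w₁ along w₂ is in ℳ; it
-- contains m and n.  Conversely, by the Van Kampen property of W, the pullback
-- of q along w₁ is T, B with a copy of K glued on along M; pulled back along y₂,
-- the part B of it lands in n and the part K in m, so r is below every
-- subobject containing m and n.
module Submission where

open import Defs
open import Data.Product.Base using (Σ-syntax; ∃-syntax; _,_; proj₁; proj₂)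
open import Function.Bundles using (module Equivalence)
open import Relation.Binary.Bundles using (Poset)
import Relation.Binary.Reasoning.Setoid as SetoidReasoning

module _ {o ℓ e} (X : Category o ℓ e) where
  open Category X

  private
    module Reasoning {A B : Obj} = SetoidReasoning (homSetoid A B)
  open Reasoning
  open Equiv using (refl; sym; trans)

  -- Associativity and cancellation in composites.

  extendʳ : ∀ {A B B′ C D} {f : A ⇒ B} {g : B ⇒ C} {h : C ⇒ D} {g′ : B ⇒ B′} {h′ : B′ ⇒ D} →
            h ∘ g ≈ h′ ∘ g′ → h ∘ (g ∘ f) ≈ h′ ∘ (g′ ∘ f)
  extendʳ eq = trans (sym assoc) (trans (∘-resp-≈ˡ eq) assoc)

  extendˡ : ∀ {A B B′ C D} {f : A ⇒ B} {g : B ⇒ C} {f′ : A ⇒ B′} {g′ : B′ ⇒ C} {h : C ⇒ D} →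
            g ∘ f ≈ g′ ∘ f′ → (h ∘ g) ∘ f ≈ (h ∘ g′) ∘ f′
  extendˡ eq = trans assoc (trans (∘-resp-≈ʳ eq) (sym assoc))

  pullˡ : ∀ {A B C D} {f : A ⇒ B} {g : B ⇒ C} {h : C ⇒ D} {k : B ⇒ D} →
          h ∘ g ≈ k → h ∘ (g ∘ f) ≈ k ∘ f
  pullˡ eq = trans (sym assoc) (∘-resp-≈ˡ eq)

  pullʳ : ∀ {A B C D} {f : A ⇒ B} {g : B ⇒ C} {h : C ⇒ D} {k : A ⇒ C} →
          g ∘ f ≈ k → (h ∘ g) ∘ f ≈ h ∘ k
  pullʳ eq = trans assoc (∘-resp-≈ʳ eq)

  cancelˡ : ∀ {A B C} {f : A ⇒ B} {g : B ⇒ C} {h : C ⇒ B} →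
            h ∘ g ≈ id → h ∘ (g ∘ f) ≈ f
  cancelˡ eq = trans (pullˡ eq) identityˡ

  cancelʳ : ∀ {A B C} {f : A ⇒ B} {g : B ⇒ A} {h : A ⇒ C} →
            g ∘ f ≈ id → (h ∘ g) ∘ f ≈ h
  cancelʳ eq = trans (pullʳ eq) identityʳ

  -- Elementary pullback and pushout squares.

  IsPullback-unique : ∀ {A B C D} {f : A ⇒ B} {m : A ⇒ C} {n : B ⇒ D} {g : C ⇒ D} →
                      IsPullback X f m n g → ∀ {Z} {u v : Z ⇒ A} →
                      f ∘ u ≈ f ∘ v → m ∘ u ≈ m ∘ v → u ≈ v
  IsPullback-unique {f = f} {m} {n} {g} pb {u = u} {v} fu≈fv mu≈mv =
    trans (unique eq fu≈fv mu≈mv) (sym (unique eq refl refl))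
    where
    open IsPullback pb
    eq : n ∘ (f ∘ v) ≈ g ∘ (m ∘ v)
    eq = extendʳ commute

  IsPushout-unique : ∀ {A B C D} {f : A ⇒ B} {m : A ⇒ C} {n : B ⇒ D} {g : C ⇒ D} →
                     IsPushout X f m n g → ∀ {Z} {u v : D ⇒ Z} →
                     u ∘ n ≈ v ∘ n → u ∘ g ≈ v ∘ g → u ≈ v
  IsPushout-unique {f = f} {m} {n} {g} po {u = u} {v} un≈vn ug≈vg =
    trans (unique eq un≈vn ug≈vg) (sym (unique eq refl refl))
    where
    open IsPushout po
    eq : (v ∘ n) ∘ f ≈ (v ∘ g) ∘ m
    eq = extendˡ commute

  IsPullback-id : ∀ {A B} {f : A ⇒ B} → IsPullback X f id id f
  IsPullback-id = record
    { commute     = trans identityˡ (sym identityʳ)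
    ; universal   = λ {_} {_} {k} _ → k
    ; f∘universal = λ eq → trans (sym eq) identityˡ
    ; m∘universal = λ _ → identityˡ
    ; unique      = λ _ _ idu≈k → trans (sym identityˡ) idu≈k
    }

  IsPullback-mono : ∀ {A B} {f : A ⇒ B} → IsMono X f → IsPullback X id id f f
  IsPullback-mono mono = record
    { commute     = refl
    ; universal   = λ {_} {_} {k} _ → k
    ; f∘universal = λ eq → trans identityˡ (sym (mono _ _ eq))
    ; m∘universal = λ _ → identityˡ
    ; unique      = λ _ _ idu≈k → trans (sym identityˡ) idu≈k
    }

  IsPushout-id : ∀ {A B} {f : A ⇒ B} → IsPushout X id f f id
  IsPushout-id = record
    { commute     = trans identityʳ (sym identityˡ)
    ; universal   = λ {_} {_} {k} _ → k
    ; universal∘n = λ eq → trans (sym eq) identityʳ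
    ; universal∘g = λ _ → identityʳ
    ; unique      = λ _ _ uid≈k → trans (sym identityʳ) uid≈k
    }

  -- Van Kampen squares.

  isVanKampen⇒isPullback : ∀ {A B C D} {g : A ⇒ B} {m : A ⇒ C} {n : B ⇒ D} {f : C ⇒ D} →
                           IsMono X g → IsVanKampen X g m n f → IsPullback X m g f n
  isVanKampen⇒isPullback g-mono vk =
    -- The cube has vertical arrows `id`, `g`, `id`, `f` and the trivial pushout of `id` along `m`
    -- on top. One back face is a pullback because `g` is mono; the front face over `n` is the
    -- square itself, transposed.
    proj₁ (Equivalence.to
      (cube (IsPushout.commute IsPushout-id) (sym (IsPushout.commute isPushout))
            refl (IsPullback-mono g-mono) IsPullback-id)
      IsPushout-id)
    where open IsVanKampen vk

  -- The missing corner is built as the pullback of `b` along `g`. The other face at that corner is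
  -- a pullback by pasting, since `n ∘ g` and `f ∘ m` agree and the face over `f` is a pullback.
  isVanKampen-stable :
    HasPullbacks X →
    ∀ {A B C D} {g : A ⇒ B} {m : A ⇒ C} {n : B ⇒ D} {f : C ⇒ D} → IsVanKampen X g m n f →
    ∀ {B′ C′ D′} {n′ : B′ ⇒ D′} {f′ : C′ ⇒ D′} {b : B′ ⇒ B} {c : C′ ⇒ C} {d : D′ ⇒ D} →
    IsPullback X n′ b d n → IsPullback X f′ c d f →
    ∃[ A′ ] Σ[ g′ ∈ A′ ⇒ B′ ] Σ[ m′ ∈ A′ ⇒ C′ ] IsPushout X g′ m′ n′ f′
  isVanKampen-stable pullbacks {g = g} {m} {n} {f} vk {n′ = n′} {f′} {b} {c} {d} pb-n pb-f =
    back.P , back.p₁ , m′ ,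
    Equivalence.from (cube (sym (F.f∘universal eq)) N.commute F.commute back.isPullback left)
                     (pb-n , pb-f)
    where
    open IsVanKampen vk
    module N = IsPullback pb-n
    module F = IsPullback pb-f
    module back = Pullback (pullbacks b g)
    module Back = IsPullback back.isPullback

    eq : d ∘ (n′ ∘ back.p₁) ≈ f ∘ (m ∘ back.p₂)
    eq = begin
      d ∘ (n′ ∘ back.p₁) ≈⟨ extendʳ N.commute ⟩
      n ∘ (b ∘ back.p₁)  ≈⟨ ∘-resp-≈ʳ Back.commute ⟩
      n ∘ (g ∘ back.p₂)  ≈⟨ extendʳ (IsPushout.commute isPushout) ⟩
      f ∘ (m ∘ back.p₂)  ∎

    m′ = F.universal eq

    left : IsPullback X m′ back.p₂ c m
    left = record
      { commute     = F.m∘universal eq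
      ; universal   = λ ch≈mk → Back.universal (N.m∘universal (eq′ ch≈mk))
      ; f∘universal = λ {_} {h} {k} ch≈mk → IsPullback-unique pb-f
          (begin
            f′ ∘ (m′ ∘ _)       ≈⟨ extendʳ (F.f∘universal eq) ⟩
            n′ ∘ (back.p₁ ∘ _)  ≈⟨ ∘-resp-≈ʳ (Back.f∘universal _) ⟩
            n′ ∘ _              ≈⟨ N.f∘universal (eq′ ch≈mk) ⟩
            f′ ∘ h              ∎)
          (begin
            c ∘ (m′ ∘ _)        ≈⟨ extendʳ (F.m∘universal eq) ⟩
            m ∘ (back.p₂ ∘ _)   ≈⟨ ∘-resp-≈ʳ (Back.m∘universal _) ⟩
            m ∘ k               ≈⟨ ch≈mk ⟨
            c ∘ h               ∎)
      ; m∘universal = λ _ → Back.m∘universal _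
      ; unique      = λ ch≈mk {u} m′u≈h pu≈k → Back.unique _
          (N.unique (eq′ ch≈mk)
            (trans (sym (extendʳ (F.f∘universal eq))) (∘-resp-≈ʳ m′u≈h))
            (trans (extendʳ Back.commute) (∘-resp-≈ʳ pu≈k)))
          pu≈k
      }
      where
      eq′ : ∀ {Z} {h : Z ⇒ _} {k : Z ⇒ _} → c ∘ h ≈ m ∘ k → d ∘ (f′ ∘ h) ≈ n ∘ (g ∘ k)
      eq′ {h = h} {k} ch≈mk = begin
        d ∘ (f′ ∘ h) ≈⟨ extendʳ F.commute ⟩
        f ∘ (c ∘ h)  ≈⟨ ∘-resp-≈ʳ ch≈mk ⟩
        f ∘ (m ∘ k)  ≈⟨ extendʳ (IsPushout.commute isPushout) ⟨
        n ∘ (g ∘ k)  ∎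

  -- An arrow class respects equality of arrows; equality of subobjects also involves an isomorphism
  -- of domains, which composition absorbs.
  ≅-resp-∈ : ∀ {p} (ℳ : ArrowClass X p) → Isos X ⊆ ℳ → ClosedUnderComposition X ℳ →
             ∀ {B} {s t : Subobject X B} → let open Subobject in
             Factors X (arrow s) (arrow t) → Factors X (arrow t) (arrow s) →
             arrow t ∈ ℳ → arrow s ∈ ℳ
  ≅-resp-∈ ℳ isos comp {B} {s} {t} s≤t t≤s t∈ =
    let (h , th≈s) , h-iso = Poset.antisym (Sub X B) {s} {t} s≤t t≤s
    in ArrowClass.resp-≈ ℳ th≈s (comp t∈ (isos h-iso))

  module Union {pℳ p𝒩} {ℳ : ArrowClass X pℳ} {𝒩 : ArrowClass X p𝒩}
    (adhesive : IsAdhesive X ℳ 𝒩) (pullbacks : HasPullbacks X)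
    (split⊆ : SplitMonos X ⊆ ℳ ∩ 𝒩) (codiagonals⊆ : Codiagonals X ℳ 𝒩 ⊆ 𝒩)
    {M N B : Obj} {m : M ⇒ B} {n : N ⇒ B} (m∈ : m ∈ ℳ) (n∈ : n ∈ ℳ ∩ 𝒩) where

    open IsAdhesive adhesive
    open IsPreadhesive isPreadhesive

    -- Two copies of `B` glued along `N`.

    module Q = Pushout (ℳ𝒩-pushouts n n (proj₁ n∈) (proj₂ n∈))
    module QP = IsPushout Q.isPushout
    open Q using () renaming (i₁ to y₁; i₂ to y₂)

    υ : Q.Q ⇒ B
    υ = QP.universal {h = id} {k = id} refl

    υ∘y₁ : υ ∘ y₁ ≈ id
    υ∘y₁ = QP.universal∘n refl

    υ∘y₂ : υ ∘ y₂ ≈ id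
    υ∘y₂ = QP.universal∘g refl

    υ∈ : υ ∈ 𝒩
    υ∈ = codiagonals⊆ (_ , n , n∈ , record
      { y₁ = y₁ ; y₂ = y₂ ; isPushout = Q.isPushout ; υ∘y₁ = υ∘y₁ ; υ∘y₂ = υ∘y₂ })

    -- What `r-least` uses to land in `N`: the two copies of `B` in `Q` meet nowhere else.
    Q-isPullback : IsPullback X n n y₂ y₁
    Q-isPullback = isVanKampen⇒isPullback (ℳ⊆Monos (proj₁ n∈))
                     (ℳ𝒩-vanKampen (proj₁ n∈) (proj₂ n∈) Q.isPushout)

    -- The preimage of `M` under the codiagonal.

    module K = Pullback (pullbacks m υ)
    module KP = IsPullback K.isPullback
    open K using () renaming (P to K; p₁ to ∇; p₂ to k)

    k∈ : k ∈ ℳ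
    k∈ = ℳ-pullback K.isPullback m∈

    k-mono : IsMono X k
    k-mono = ℳ⊆Monos k∈

    ∇∈ : ∇ ∈ 𝒩
    ∇∈ = 𝒩-pullback (record
      { commute     = sym KP.commute
      ; universal   = λ eq → KP.universal (sym eq)
      ; f∘universal = λ eq → KP.m∘universal (sym eq)
      ; m∘universal = λ eq → KP.f∘universal (sym eq)
      ; unique      = λ eq ku ∇u → KP.unique (sym eq) ∇u ku
      }) υ∈

    -- The condition by which each section `y` of `υ` induces a section of `∇`, so that `K` contains
    -- both copies of `M`.
    section : {y : B ⇒ Q.Q} → υ ∘ y ≈ id → m ∘ id ≈ υ ∘ (y ∘ m)
    section υy≈id = trans identityʳ (sym (cancelˡ υy≈id))

    ι₁ : M ⇒ K
    ι₁ = KP.universal (section υ∘y₁)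

    ι₂ : M ⇒ K
    ι₂ = KP.universal (section υ∘y₂)

    ∇∘ι₁ : ∇ ∘ ι₁ ≈ id
    ∇∘ι₁ = KP.f∘universal _

    k∘ι₁ : k ∘ ι₁ ≈ y₁ ∘ m
    k∘ι₁ = KP.m∘universal _

    -- Identifying the two copies of `M`.

    module W = Pushout (ℳ𝒩-pushouts k ∇ k∈ ∇∈)
    module WP = IsPushout W.isPushout
    open W using () renaming (i₁ to q; i₂ to j)

    w₁ w₂ : B ⇒ W.Q
    w₁ = q ∘ y₁
    w₂ = q ∘ y₂

    w₁∘m : w₁ ∘ m ≈ j
    w₁∘m = begin
      (q ∘ y₁) ∘ m  ≈⟨ extendˡ k∘ι₁ ⟨
      (q ∘ k) ∘ ι₁  ≈⟨ ∘-resp-≈ˡ WP.commute ⟩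
      (j ∘ ∇) ∘ ι₁  ≈⟨ cancelʳ ∇∘ι₁ ⟩
      j             ∎

    w₂∘m : w₂ ∘ m ≈ j
    w₂∘m = begin
      (q ∘ y₂) ∘ m  ≈⟨ extendˡ (KP.m∘universal (section υ∘y₂)) ⟨
      (q ∘ k) ∘ ι₂  ≈⟨ ∘-resp-≈ˡ WP.commute ⟩
      (j ∘ ∇) ∘ ι₂  ≈⟨ cancelʳ (KP.f∘universal (section υ∘y₂)) ⟩
      j             ∎

    -- The codiagonal descends to `W` because on `K` it factors through `∇`; this retraction puts
    -- `w₁` in `ℳ`.
    ω : W.Q ⇒ B
    ω = WP.universal (sym KP.commute)

    ω∘q : ω ∘ q ≈ υ
    ω∘q = WP.universal∘n _

    ω∘w₁ : ω ∘ w₁ ≈ id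
    ω∘w₁ = trans (pullˡ ω∘q) υ∘y₁

    w₁∈ : w₁ ∈ ℳ
    w₁∈ = proj₁ (split⊆ (ω , ω∘w₁))

    -- The intersection of the two copies of `B` in `W`.

    module R = Pullback (pullbacks w₁ w₂)
    module RP = IsPullback R.isPullback
    open R using () renaming (p₁ to r₁; p₂ to r)

    r∈ : r ∈ ℳ
    r∈ = ℳ-pullback R.isPullback w₁∈

    m≤r : Factors X m r
    m≤r = RP.universal eq , RP.m∘universal eq
      where eq = trans w₁∘m (sym w₂∘m)

    n≤r : Factors X n r
    n≤r = RP.universal (extendˡ QP.commute) , RP.m∘universal _

    -- The preimage of the first copy of `B` under `q`.

    module T = Pushout (ℳ𝒩-pushouts m ι₁ m∈ (proj₂ (split⊆ (∇ , ∇∘ι₁))))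
    module TP = IsPushout T.isPushout
    open T using () renaming (i₁ to s; i₂ to t)

    T-isVanKampen : IsVanKampen X m ι₁ s t
    T-isVanKampen = ℳ𝒩-vanKampen m∈ (proj₂ (split⊆ (∇ , ∇∘ι₁))) T.isPushout

    -- Lets arrows out of `Z` be compared and defined piecewise, on the preimages of `B` and of `K`.
    T-cover : ∀ {Z} (h : Z ⇒ T.Q) → let module S = Pullback (pullbacks h s)
                                        module U = Pullback (pullbacks h t) in
              ∃[ A ] Σ[ g ∈ A ⇒ S.P ] Σ[ f ∈ A ⇒ U.P ] IsPushout X g f S.p₁ U.p₁
    T-cover h = isVanKampen-stable pullbacks T-isVanKampen
                  (Pullback.isPullback (pullbacks h s)) (Pullback.isPullback (pullbacks h t))

    b : T.Q ⇒ Q.Q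
    b = TP.universal (sym k∘ι₁)

    b∘s : b ∘ s ≈ y₁
    b∘s = TP.universal∘n _

    b∘t : b ∘ t ≈ k
    b∘t = TP.universal∘g _

    β-eq : id ∘ m ≈ (m ∘ ∇) ∘ ι₁
    β-eq = trans identityˡ (sym (cancelʳ ∇∘ι₁))

    β : T.Q ⇒ B
    β = TP.universal β-eq

    β∘s : β ∘ s ≈ id
    β∘s = TP.universal∘n β-eq

    β∘t : β ∘ t ≈ m ∘ ∇
    β∘t = TP.universal∘g β-eq

    -- Cancellation of pushouts: pasting with the square of `T` gives a square in which `∇ ∘ ι₁` and
    -- `β ∘ s` are identities, and such a square is a pushout.
    top-isPushout : IsPushout X t ∇ β m
    top-isPushout = record
      { commute     = β∘t
      ; universal   = λ {_} {h} _ → h ∘ s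
      ; universal∘n = λ {_} {h} {l} ht≈l∇ → IsPushout-unique T.isPushout
          (cancelʳ β∘s)
          (begin
            ((h ∘ s) ∘ β) ∘ t  ≈⟨ pullʳ β∘t ⟩
            (h ∘ s) ∘ (m ∘ ∇)  ≈⟨ pullˡ (hsm≈l ht≈l∇) ⟩
            l ∘ ∇              ≈⟨ ht≈l∇ ⟨
            h ∘ t              ∎)
      ; universal∘g = hsm≈l
      ; unique      = λ _ uβ≈h _ → trans (sym (cancelʳ β∘s)) (∘-resp-≈ˡ uβ≈h)
      }
      where
      hsm≈l : ∀ {Z} {h : T.Q ⇒ Z} {l : M ⇒ Z} → h ∘ t ≈ l ∘ ∇ → (h ∘ s) ∘ m ≈ l
      hsm≈l {h = h} {l} ht≈l∇ = begin
        (h ∘ s) ∘ m   ≈⟨ extendˡ TP.commute ⟩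
        (h ∘ t) ∘ ι₁  ≈⟨ ∘-resp-≈ˡ ht≈l∇ ⟩
        (l ∘ ∇) ∘ ι₁  ≈⟨ cancelʳ ∇∘ι₁ ⟩
        l             ∎

    -- The point is that any `h` with `b ∘ h` factoring through `k` lands in the part `t`. `T-cover`
    -- reduces this to the two parts of its domain.
    back-isPullback : IsPullback X t id b k
    back-isPullback = record
      { commute     = trans b∘t (sym identityʳ)
      ; universal   = λ {_} {_} {κ} _ → κ
      ; f∘universal = λ bh≈kκ → sym (factor bh≈kκ)
      ; m∘universal = λ _ → identityˡ
      ; unique      = λ _ _ idu≈κ → trans (sym identityˡ) idu≈κ
      }
      where
      -- Applying `υ` shows that `x` lies in `M`, where `T` glues `B` to `K`.
      over-s : ∀ {Z} {x : Z ⇒ B} {κ : Z ⇒ K} → y₁ ∘ x ≈ k ∘ κ → s ∘ x ≈ t ∘ κ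
      over-s {x = x} {κ} y₁x≈kκ = begin
        s ∘ x              ≈⟨ ∘-resp-≈ʳ x≈m∇κ ⟩
        s ∘ (m ∘ (∇ ∘ κ))  ≈⟨ extendʳ TP.commute ⟩
        t ∘ (ι₁ ∘ (∇ ∘ κ)) ≈⟨ ∘-resp-≈ʳ (k-mono _ _ kι₁∇κ≈kκ) ⟩
        t ∘ κ              ∎
        where
        x≈m∇κ : x ≈ m ∘ (∇ ∘ κ)
        x≈m∇κ = begin
          x              ≈⟨ cancelˡ υ∘y₁ ⟨
          υ ∘ (y₁ ∘ x)   ≈⟨ ∘-resp-≈ʳ y₁x≈kκ ⟩
          υ ∘ (k ∘ κ)    ≈⟨ extendʳ KP.commute ⟨
          m ∘ (∇ ∘ κ)    ∎

        kι₁∇κ≈kκ : k ∘ (ι₁ ∘ (∇ ∘ κ)) ≈ k ∘ κ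
        kι₁∇κ≈kκ = begin
          k ∘ (ι₁ ∘ (∇ ∘ κ)) ≈⟨ extendʳ k∘ι₁ ⟩
          y₁ ∘ (m ∘ (∇ ∘ κ)) ≈⟨ ∘-resp-≈ʳ x≈m∇κ ⟨
          y₁ ∘ x             ≈⟨ y₁x≈kκ ⟩
          k ∘ κ              ∎

      over-t : ∀ {Z} {x κ : Z ⇒ K} → k ∘ x ≈ k ∘ κ → t ∘ x ≈ t ∘ κ
      over-t kx≈kκ = ∘-resp-≈ʳ (k-mono _ _ kx≈kκ)

      factor : ∀ {Z} {h : Z ⇒ T.Q} {κ : Z ⇒ K} → b ∘ h ≈ k ∘ κ → h ≈ t ∘ κ
      factor {h = h} {κ} bh≈kκ =
        let _ , _ , _ , po = T-cover h
        in IsPushout-unique po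
             (on-part (IsPullback.commute S.isPullback) b∘s over-s)
             (on-part (IsPullback.commute U.isPullback) b∘t over-t)
        where
        module S = Pullback (pullbacks h s)
        module U = Pullback (pullbacks h t)

        on-part : ∀ {P A} {p : P ⇒ _} {x : P ⇒ A} {i : A ⇒ T.Q} {y : A ⇒ Q.Q} →
                  h ∘ p ≈ i ∘ x → b ∘ i ≈ y →
                  (∀ {κ′ : P ⇒ K} → y ∘ x ≈ k ∘ κ′ → i ∘ x ≈ t ∘ κ′) → h ∘ p ≈ (t ∘ κ) ∘ p
        on-part {p = p} {x} {i} {y} hp≈ix bi≈y over = begin
          h ∘ p        ≈⟨ hp≈ix ⟩
          i ∘ x        ≈⟨ over yx≈kκp ⟩
          t ∘ (κ ∘ p)  ≈⟨ assoc ⟨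
          (t ∘ κ) ∘ p  ∎
          where
          yx≈kκp : y ∘ x ≈ k ∘ (κ ∘ p)
          yx≈kκp = begin
            y ∘ x        ≈⟨ pullˡ bi≈y ⟨
            b ∘ (i ∘ x)  ≈⟨ ∘-resp-≈ʳ hp≈ix ⟨
            b ∘ (h ∘ p)  ≈⟨ extendʳ bh≈kκ ⟩
            k ∘ (κ ∘ p)  ∎

    -- A front face of the cube over the square of `W` with vertical arrows `id`, `b`, `id`, `w₁`
    -- and `top-isPushout` on top.
    T-isPullback : IsPullback X β b w₁ q
    T-isPullback = proj₁ (Equivalence.to
      (IsVanKampen.cube (ℳ𝒩-vanKampen k∈ ∇∈ W.isPushout)
        β∘t w₁∘β (trans w₁∘m (sym identityʳ)) back-isPullback IsPullback-id)
      top-isPushout)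
      where
      w₁∘β : w₁ ∘ β ≈ q ∘ b
      w₁∘β = IsPushout-unique T.isPushout
        (begin
          (w₁ ∘ β) ∘ s  ≈⟨ cancelʳ β∘s ⟩
          q ∘ y₁        ≈⟨ pullʳ b∘s ⟨
          (q ∘ b) ∘ s   ∎)
        (begin
          (w₁ ∘ β) ∘ t  ≈⟨ pullʳ β∘t ⟩
          w₁ ∘ (m ∘ ∇)  ≈⟨ pullˡ w₁∘m ⟩
          j ∘ ∇         ≈⟨ WP.commute ⟨
          q ∘ k         ≈⟨ pullʳ b∘t ⟨
          (q ∘ b) ∘ t   ∎)

    -- Minimality of `r`.

    r-least : ∀ {U} {u : U ⇒ B} → IsMono X u → Factors X m u → Factors X n u → Factors X r u
    r-least {u = u} u-mono (g , ug≈m) (h , uh≈n) =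
      P.universal eq , IsPushout-unique po
        (trans (pullʳ (P.universal∘n eq)) u∘φ)
        (trans (pullʳ (P.universal∘g eq)) u∘ψ)
      where
      -- As `w₂` is `q ∘ y₂`, the square of `R` is a cone over `w₁` and `q` with legs `r₁` and
      -- `y₂ ∘ r`.
      d : R.P ⇒ T.Q
      d = IsPullback.universal T-isPullback (trans RP.commute assoc)
      module S = Pullback (pullbacks d s)
      module V = Pullback (pullbacks d t)

      cover = T-cover d
      po = proj₂ (proj₂ (proj₂ cover))
      module P = IsPushout po

      b∘d : b ∘ d ≈ y₂ ∘ r
      b∘d = IsPullback.m∘universal T-isPullback _

      -- On the part over `B`, `y₂ ∘ r` also lies in the first copy of `B`, hence in `N`.
      meets-N : y₂ ∘ (r ∘ S.p₁) ≈ y₁ ∘ S.p₂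
      meets-N = begin
        y₂ ∘ (r ∘ S.p₁)  ≈⟨ extendʳ b∘d ⟨
        b ∘ (d ∘ S.p₁)   ≈⟨ ∘-resp-≈ʳ (IsPullback.commute S.isPullback) ⟩
        b ∘ (s ∘ S.p₂)   ≈⟨ pullˡ b∘s ⟩
        y₁ ∘ S.p₂        ∎

      φ = h ∘ IsPullback.universal Q-isPullback meets-N
      ψ = g ∘ (∇ ∘ V.p₂)

      u∘φ : u ∘ φ ≈ r ∘ S.p₁
      u∘φ = trans (pullˡ uh≈n) (IsPullback.f∘universal Q-isPullback meets-N)

      -- On the part over `K`, `υ` undoes `y₂` and sends `K` into `M`, so `r` factors through `m`.
      u∘ψ : u ∘ ψ ≈ r ∘ V.p₁
      u∘ψ = begin
        u ∘ (g ∘ (∇ ∘ V.p₂))   ≈⟨ pullˡ ug≈m ⟩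
        m ∘ (∇ ∘ V.p₂)         ≈⟨ extendʳ KP.commute ⟩
        υ ∘ (k ∘ V.p₂)         ≈⟨ ∘-resp-≈ʳ (pullˡ b∘t) ⟨
        υ ∘ (b ∘ (t ∘ V.p₂))   ≈⟨ ∘-resp-≈ʳ (∘-resp-≈ʳ (IsPullback.commute V.isPullback)) ⟨
        υ ∘ (b ∘ (d ∘ V.p₁))   ≈⟨ ∘-resp-≈ʳ (extendʳ b∘d) ⟩
        υ ∘ (y₂ ∘ (r ∘ V.p₁))  ≈⟨ cancelˡ υ∘y₂ ⟩
        r ∘ V.p₁               ∎

      -- Both pieces become restrictions of `r` after `u`, so they agree on the overlap.
      eq : φ ∘ proj₁ (proj₂ cover) ≈ ψ ∘ proj₁ (proj₂ (proj₂ cover))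
      eq = u-mono _ _ (begin
        u ∘ (φ ∘ _)      ≈⟨ extendʳ u∘φ ⟩
        r ∘ (S.p₁ ∘ _)   ≈⟨ ∘-resp-≈ʳ P.commute ⟩
        r ∘ (V.p₁ ∘ _)   ≈⟨ extendʳ u∘ψ ⟨
        u ∘ (ψ ∘ _)      ∎)

theorem5p5 : ∀ {o ℓ e p q} (X : Category o ℓ e)
    (ℳ : ArrowClass X p) (𝒩 : ArrowClass X q) →
    IsAdhesive X ℳ 𝒩 →
    HasPullbacks X →
    SplitMonos X ⊆ ℳ ∩ 𝒩 →
    Codiagonals X ℳ 𝒩 ⊆ 𝒩 →
    ClosedUnderUnions X ℳ 𝒩
theorem5p5 X ℳ 𝒩 adhesive pullbacks split⊆ codiagonals⊆
  {f = u} (u-mono , _ , _ , m∈ , n∈ , m≤u , n≤u , least) =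
  -- The join property gives `u` below `r`, and `r-least` the converse.
  ≅-resp-∈ X ℳ Isos⊆ℳ ℳ-composition {s = record { mono = u-mono }} {t = r-sub}
    (least r-sub m≤r n≤r) (r-least u-mono m≤u n≤u) r∈
  where
  open IsPreadhesive (IsAdhesive.isPreadhesive adhesive)
  open Union X adhesive pullbacks split⊆ codiagonals⊆ m∈ n∈

  r-sub : Subobject X _
  r-sub = record { mono = ℳ⊆Monos r∈ }
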